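{- For every nonnegative integer $n$, $$\sum_{j=0}^{\infty}pod(j)\,p\!\left(\frac n2-\frac j2\right)=\sum_{j=0}^{\infty}p(j)\,p\!\left(\frac n4-\frac j4\right),$$ where $p(x)=0$ if $x$ is not an integer.
   Context: $p(n)$ denotes the number of (unrestricted) partitions of $n$, with $p(0)=1$ and $p(x)=0$ for $x<0$. $pod(n)$ denotes the number of partitions of $n$ in which odd parts are distinct and even parts may be repeated, with $pod(0)=1$. -}

module Defs where

import Data.Integer.Base as ℤ
open import Data.List.Base
  using (List; []; _∷_; _++_; applyUpTo; concatMap; filter; length; map; replicate; upTo)
open import Data.List.Membership.Propositional using (_∈_; lose; find)
open import Data.List.Membership.Propositional.Properties
  using (∈-concatMap⁺; ∈-concatMap⁻; ∈-map⁺; ∈-map⁻; ∈-upTo⁺; ∈-upTo⁻)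
open import Data.List.Properties using (++-cancelˡ; ∷-injective)
open import Data.List.Relation.Binary.Disjoint.Propositional using (Disjoint)
open import Data.List.Relation.Unary.All as All using (All; []; _∷_)
import Data.List.Relation.Unary.All.Properties as Allₚ
open import Data.List.Relation.Unary.AllPairs as AllPairs using (AllPairs; []; _∷_)
import Data.List.Relation.Unary.AllPairs.Properties as AllPairsₚ
open import Data.List.Relation.Unary.Any using (here)
open import Data.List.Relation.Unary.Linked as Linked using (Linked; []; [-]; _∷_)
import Data.List.Relation.Unary.Linked.Properties as Linkedₚ
open import Data.List.Relation.Unary.Unique.Propositional using (Unique)
import Data.List.Relation.Unary.Unique.Propositional.Properties as Uniqueₚ
open import Data.Nat.Base
open import Data.Nat.DivMod using (_/_; m/n*n≤m; m*n/n≡m; /-monoˡ-≤)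
open import Data.Nat.Divisibility using (_∣_; _∣?_)
open import Data.Nat.ListAction using (sum)
open import Data.Nat.ListAction.Properties using (sum-++)
open import Data.Nat.Properties
open import Data.List.Relation.Unary.Unique.DecPropositional _≟_ using (unique?)
open import Data.Product.Base using (∃-syntax; _×_; _,_; proj₁; proj₂)
open import Data.Rational.Base using (ℚ; mkℚ)
open import Function.Bundles using (_⇔_; mk⇔)
open import Relation.Binary.PropositionalEquality
open import Relation.Nullary using (¬_; ¬?; yes; no; contradiction)
open import Relation.Unary using (Decidable)

record IsPartition (n : ℕ) (ps : List ℕ) : Set where
  constructor isPartition
  field
    positive : All (1 ≤_) ps
    sorted   : Linked _≥_ ps
    total    : sum ps ≡ n

-- The partitions of n into parts of size at most k, grouped by the
-- multiplicity m of the part k.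
partitions≤ : (k n : ℕ) → List (List ℕ)
partitions≤ zero    zero    = [] ∷ []
partitions≤ zero    (suc n) = []
partitions≤ (suc k) n       =
  concatMap (λ m → map (replicate m (suc k) ++_) (partitions≤ k (n ∸ m * suc k)))
            (upTo (suc (n / suc k)))

-- Correctness of the enumeration: see ∈-partitions⇔ and partitions-unique.
partitions : ℕ → List (List ℕ)
partitions n = partitions≤ n n

p : ℕ → ℕ
p n = length (partitions n)

Odd : ℕ → Set
Odd k = ¬ (2 ∣ k)

odd? : Decidable Odd
odd? k = ¬? (2 ∣? k)

OddPartsDistinct : List ℕ → Set
OddPartsDistinct ps = Unique (filter odd? ps)

oddPartsDistinct? : Decidable OddPartsDistinct
oddPartsDistinct? ps = unique? (filter odd? ps)

pod : ℕ → ℕ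
pod n = length (filter oddPartsDistinct? (partitions n))

-- p extended by zero to the rationals that are not nonnegative integers.
-- Elements of ℚ are in lowest terms, so the integers are exactly those whose
-- field denominator-1 is 0.
pℚ : ℚ → ℕ
pℚ (mkℚ (ℤ.+ n) 0 _) = p n
pℚ (mkℚ _       _ _) = 0

-- Convergence of the series ∑_{j≥0} f j in the discrete space ℕ: the partial
-- sums are eventually equal to s.
HasSum : (ℕ → ℕ) → ℕ → Set
HasSum f s = ∃[ N ] (∀ M → N ≤ M → sum (applyUpTo f M) ≡ s)

private

  sum-replicate : ∀ m x → sum (replicate m x) ≡ m * x
  sum-replicate zero    x = refl
  sum-replicate (suc m) x = cong (x +_) (sum-replicate m x)

  sorted-++ : ∀ m {k ps} → All (_≤ k) ps → Linked _≥_ ps →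
              Linked _≥_ (replicate m (suc k) ++ ps)
  sorted-++ zero          ps≤k ps↘ = ps↘
  sorted-++ (suc zero)    []          ps↘ = [-]
  sorted-++ (suc zero)    (x≤k ∷ _)   ps↘ = m≤n⇒m≤1+n x≤k ∷ ps↘
  sorted-++ (suc (suc m)) ps≤k ps↘ = ≤-refl ∷ sorted-++ (suc m) ps≤k ps↘

  split : ∀ {k ps} → All (_≤ suc k) ps → Linked _≥_ ps →
          ∃[ m ] ∃[ qs ] (ps ≡ replicate m (suc k) ++ qs × All (_≤ k) qs × Linked _≥_ qs)
  split {ps = []} _ _ = 0 , [] , refl , [] , []
  split {k} {x ∷ ps} (x≤1+k ∷ ps≤1+k) ps↘ with x ≟ suc k
  ... | yes refl =
    let m , qs , eq , qs≤k , qs↘ = split ps≤1+k (Linked.tail ps↘)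
    in  suc m , qs , cong (suc k ∷_) eq , qs≤k , qs↘
  ... | no x≢1+k =
    let x≤k = s≤s⁻¹ (≤∧≢⇒< x≤1+k x≢1+k)
    in  0 , x ∷ ps , refl , Linkedₚ.Linked⇒All (λ a≥b b≥c → ≤-trans b≥c a≥b) x≤k ps↘ , ps↘

  replicate-injective : ∀ m m′ {k ps qs} → All (_≤ k) ps → All (_≤ k) qs →
                        replicate m (suc k) ++ ps ≡ replicate m′ (suc k) ++ qs → m ≡ m′
  replicate-injective zero    zero     _         _         _    = refl
  replicate-injective zero    (suc m′) (x≤k ∷ _) _         refl = contradiction x≤k 1+n≰n
  replicate-injective (suc m) zero     _         (x≤k ∷ _) refl = contradiction x≤k 1+n≰n
  replicate-injective (suc m) (suc m′) ps≤k      qs≤k      eq   =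
    cong suc (replicate-injective m m′ ps≤k qs≤k (proj₂ (∷-injective eq)))

  quotient-bound : ∀ m k n → m < suc (n / suc k) → m * suc k ≤ n
  quotient-bound m k n m<1+n/k =
    ≤-trans (*-monoˡ-≤ (suc k) (s≤s⁻¹ m<1+n/k)) (m/n*n≤m n (suc k))

  sound : ∀ k n {ps} → ps ∈ partitions≤ k n → All (_≤ k) ps × IsPartition n ps
  sound zero    zero (here refl) = [] , isPartition [] [] refl
  sound (suc k) n    ps∈ with find (∈-concatMap⁻ _ {xs = upTo (suc (n / suc k))} ps∈)
  ... | m , m∈ , ps∈′ with ∈-map⁻ _ ps∈′
  ... | qs , qs∈ , refl with sound k (n ∸ m * suc k) qs∈
  ... | qs≤k , isPartition qs>0 qs↘ Σqs =
    Allₚ.++⁺ (Allₚ.replicate⁺ m ≤-refl) (All.map m≤n⇒m≤1+n qs≤k) ,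
    isPartition (Allₚ.++⁺ (Allₚ.replicate⁺ m (s≤s z≤n)) qs>0) (sorted-++ m qs≤k qs↘) (begin
      sum (replicate m (suc k) ++ qs)       ≡⟨ sum-++ (replicate m (suc k)) qs ⟩
      sum (replicate m (suc k)) + sum qs    ≡⟨ cong₂ _+_ (sum-replicate m (suc k)) Σqs ⟩
      m * suc k + (n ∸ m * suc k)           ≡⟨ m+[n∸m]≡n (quotient-bound m k n (∈-upTo⁻ m∈)) ⟩
      n                                     ∎)
    where open ≡-Reasoning

  complete : ∀ k n {ps} → All (_≤ k) ps → IsPartition n ps → ps ∈ partitions≤ k n
  complete zero    zero    []            (isPartition _ _ _)             = here refl
  complete zero    (suc n) []            (isPartition _ _ ())
  complete zero    n       (x≤0 ∷ _)     (isPartition (x>0 ∷ _) _ _)    =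
    contradiction (≤-trans x>0 x≤0) 1+n≰n
  complete (suc k) n ps≤ (isPartition ps>0 ps↘ Σps) with split ps≤ ps↘
  ... | m , qs , refl , qs≤k , qs↘ =
    ∈-concatMap⁺ _ (lose (∈-upTo⁺ (s≤s m≤n/k)) (∈-map⁺ _ (complete k (n ∸ m * suc k) qs≤k
      (isPartition (Allₚ.++⁻ʳ (replicate m (suc k)) ps>0) qs↘ Σqs))))
    where
    n≡ : m * suc k + sum qs ≡ n
    n≡ = trans (cong (_+ sum qs) (sym (sum-replicate m (suc k))))
               (trans (sym (sum-++ (replicate m (suc k)) qs)) Σps)
    Σqs : sum qs ≡ n ∸ m * suc k
    Σqs = trans (sym (m+n∸m≡n (m * suc k) (sum qs))) (cong (_∸ m * suc k) n≡)
    m≤n/k : m ≤ n / suc k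
    m≤n/k = subst (_≤ n / suc k) (m*n/n≡m m (suc k))
      (/-monoˡ-≤ (suc k) (subst (m * suc k ≤_) n≡ (m≤m+n (m * suc k) (sum qs))))

  unique : ∀ k n → Unique (partitions≤ k n)
  unique zero    zero    = [] ∷ []
  unique zero    (suc n) = []
  unique (suc k) n       = Uniqueₚ.concat⁺
    (Allₚ.map⁺ (All.universal
      (λ m → Uniqueₚ.map⁺ (λ {x} {y} → ++-cancelˡ (replicate m (suc k)) x y)
                          (unique k (n ∸ m * suc k)))
      (upTo (suc (n / suc k)))))
    (AllPairsₚ.map⁺ (AllPairs.map disjoint (Uniqueₚ.upTo⁺ (suc (n / suc k)))))
    where
    disjoint : ∀ {m m′} → m ≢ m′ →
               Disjoint (map (replicate m  (suc k) ++_) (partitions≤ k (n ∸ m  * suc k)))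
                        (map (replicate m′ (suc k) ++_) (partitions≤ k (n ∸ m′ * suc k)))
    disjoint {m} {m′} m≢m′ (v∈ , v∈′) with ∈-map⁻ _ v∈ | ∈-map⁻ _ v∈′
    ... | ps , ps∈ , refl | qs , qs∈ , eq =
      m≢m′ (replicate-injective m m′ (proj₁ (sound k _ ps∈)) (proj₁ (sound k _ qs∈)) eq)

  part≤sum : ∀ ps → All (_≤ sum ps) ps
  part≤sum []       = []
  part≤sum (x ∷ ps) =
    m≤m+n x (sum ps) ∷ All.map (λ y≤ → ≤-trans y≤ (m≤n+m (sum ps) x)) (part≤sum ps)

∈-partitions⇔ : ∀ n ps → ps ∈ partitions n ⇔ IsPartition n ps
∈-partitions⇔ n ps = mk⇔
  (λ ps∈ → proj₂ (sound n n ps∈))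
  (λ ps⊢n → complete n n (subst (λ s → All (_≤ s) ps) (IsPartition.total ps⊢n) (part≤sum ps)) ps⊢n)

partitions-unique : ∀ n → Unique (partitions n)
partitions-unique n = unique n n

{-# OPTIONS --safe #-}
-- Write P_K and POD_K for the generating functions of the partitions with parts
-- at most K.  The identity already holds for finite products:
-- POD_{2M}(q) P_{2M}(q²) = P_{2M}(q) P_M(q⁴).  Passing from M to M + 1 multiplies
-- both sides by 1/((1 - q^{2M+2})(1 - q^{4M+4})), the left side further by
-- (1 + q^{2M+1})/(1 - q^{4M+2}) and the right side by 1/(1 - q^{2M+1}), which are
-- equal.  Coefficients up to q^n do not change once M ≥ n.
module Submission where

open import Defs
open import Data.Nat.Base using (ℕ; _*_)
open import Data.Integer.Base using (+_)
open import Data.Rational.Base using (_/_; _-_)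
open import Data.Product.Base using (∃-syntax; _×_)

import Data.Integer.Base as ℤ
import Data.Integer.Properties as ℤ
open import Data.Integer.Tactic.RingSolver using (solve-∀)
open import Data.List.Base
  using (List; []; _∷_; _++_; applyUpTo; concatMap; filter; length; map; replicate; upTo)
open import Data.List.Properties
  using (length-++; length-map; filter-++; filter-accept; filter-none; map-upTo)
open import Data.List.Relation.Unary.All as All using (All; []; _∷_)
import Data.List.Relation.Unary.All.Properties as All
open import Data.List.Relation.Unary.AllPairs using (_∷_)
open import Data.Nat.Base hiding (_/_)
import Data.Nat.DivMod as ℕ
open import Data.Nat.Coprimality using (1-coprimeTo) renaming (sym to coprime-sym)
open import Data.Nat.Divisibility
  using (_∣_; _∣?_; divides; ∣m∣n⇒∣m+n; ∣m+n∣m⇒∣n; n∣m*n; ∣1⇒≡1)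
open import Data.Nat.Induction using (<-rec)
open import Data.Nat.ListAction using (sum)
open import Data.Nat.Properties
open import Algebra.Properties.CommutativeSemigroup +-commutativeSemigroup using (interchange)
open import Data.Product.Base using (_,_)
import Data.Rational.Base as ℚ
open import Data.Rational.Base using (mkℚ; toℚᵘ)
open import Data.Rational.Properties using (toℚᵘ-injective; toℚᵘ-homo-+; toℚᵘ-homo‿-; toℚᵘ-fromℚᵘ)
open import Data.Rational.Unnormalised.Base as ℚᵘ using (mkℚᵘ; *≡*) renaming (_≃_ to _≃ᵘ_)
import Data.Rational.Unnormalised.Properties as ℚᵘ
open import Data.Sum.Base using (inj₁; inj₂)
open import Function.Base using (_∘_)
open import Function.Bundles using (_⇔_; mk⇔; Equivalence)
open import Relation.Binary.PropositionalEquality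
open import Relation.Nullary using (¬_; Dec; yes; no; contradiction)
open import Relation.Unary using (Pred; Decidable)
open import Level using (0ℓ)

-- Power series, represented by their coefficients

-- Multiplication by q^d.
shift : ℕ → (ℕ → ℕ) → ℕ → ℕ
shift zero    f n       = f n
shift (suc d) f zero    = 0
shift (suc d) f (suc n) = shift d f n

shift-cong : ∀ d {f g} n → (∀ m → m ≤ n → f m ≡ g m) → shift d f n ≡ shift d g n
shift-cong zero    n       f≗g = f≗g n ≤-refl
shift-cong (suc d) zero    f≗g = refl
shift-cong (suc d) (suc n) f≗g = shift-cong d n (λ m m≤n → f≗g m (m≤n⇒m≤1+n m≤n))

shift-+ : ∀ d f g n → shift d (λ m → f m + g m) n ≡ shift d f n + shift d g n
shift-+ zero    f g n       = refl
shift-+ (suc d) f g zero    = refl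
shift-+ (suc d) f g (suc n) = shift-+ d f g n

shift-shift : ∀ d e f n → shift d (shift e f) n ≡ shift (d + e) f n
shift-shift zero    e f n       = refl
shift-shift (suc d) e f zero    = refl
shift-shift (suc d) e f (suc n) = shift-shift d e f n

shift-< : ∀ {d n} f → n < d → shift d f n ≡ 0
shift-< {suc d} {zero}  f _         = refl
shift-< {suc d} {suc n} f (s≤s n<d) = shift-< f n<d

shift-≤ : ∀ d f n → shift d f (d + n) ≡ f n
shift-≤ zero    f n = refl
shift-≤ (suc d) f n = shift-≤ d f n

-- The equation f = (1 - q^d) h.
_≈[1-q^_]_ : (ℕ → ℕ) → ℕ → (ℕ → ℕ) → Set
f ≈[1-q^ d ] h = ∀ n → h n ≡ f n + shift d h n

-- As the exponent is positive, the equation determines each coefficient of the quotient from the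
-- numerator and strictly earlier coefficients. This stands in for division by 1 - q^{d+1}.
quotient-unique : ∀ d {f g h k} → f ≈[1-q^ suc d ] h → g ≈[1-q^ suc d ] k → f ≗ g → h ≗ k
quotient-unique d {f} {g} {h} {k} fh gk f≗g = <-rec _ λ where
  zero    rec → trans (fh 0) (trans (cong (_+ 0) (f≗g 0)) (sym (gk 0)))
  (suc n) rec → trans (fh (suc n))
    (trans (cong₂ _+_ (f≗g (suc n)) (shift-cong d n (λ m m≤n → rec (s≤s m≤n))))
           (sym (gk (suc n))))

-- (1 + q^d)/(1 - q^{2d}) = 1/(1 - q^d): f + q^d h solves the equation defining h.
quotient-double : ∀ d {f g h} → (∀ n → g n ≡ f n + shift (suc d) f n) →
                  g ≈[1-q^ suc d + suc d ] h → f ≈[1-q^ suc d ] h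
quotient-double d {f} {g} {h} g≗ gh = quotient-unique (d + suc d) gh gh′ (λ _ → refl)
  where
  D = suc d
  h′ : ℕ → ℕ
  h′ n = f n + shift D h n
  gh′ : g ≈[1-q^ D + D ] h′
  gh′ n = begin
    f n + shift D h n
      ≡⟨ cong (λ x → f n + x) (shift-cong D n (λ m _ → trans (gh m) (cong (_+ shift (D + D) h m) (g≗ m)))) ⟩
    f n + shift D (λ m → f m + shift D f m + shift (D + D) h m) n
      ≡⟨ cong (λ x → f n + x) (shift-+ D _ _ n) ⟩
    f n + (shift D (λ m → f m + shift D f m) n + shift D (shift (D + D) h) n)
      ≡⟨ cong₂ (λ x y → f n + (x + y)) (shift-+ D _ _ n) (shift-shift D (D + D) h n) ⟩
    f n + ((shift D f n + shift D (shift D f) n) + shift (D + (D + D)) h n)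
      -- Here q^D q^{2D} h becomes q^{2D} q^D h, so that q^{2D} can be factored out of the last two
      -- terms.
      ≡⟨ cong₂ (λ x y → f n + ((shift D f n + x) + y)) (shift-shift D D f n)
               (trans (cong (λ e → shift e h n) (sym (+-assoc D D D))) (sym (shift-shift (D + D) D h n))) ⟩
    f n + ((shift D f n + shift (D + D) f n) + shift (D + D) (shift D h) n)
      ≡⟨ cong (λ x → f n + x) (+-assoc (shift D f n) _ _) ⟩
    f n + (shift D f n + (shift (D + D) f n + shift (D + D) (shift D h) n))
      ≡⟨ +-assoc (f n) _ _ ⟨
    (f n + shift D f n) + (shift (D + D) f n + shift (D + D) (shift D h) n)
      ≡⟨ cong₂ _+_ (g≗ n) (shift-+ (D + D) f (shift D h) n) ⟨
    g n + shift (D + D) h′ n ∎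
    where open ≡-Reasoning

-- Finite sums and the Cauchy product

sum-applyUpTo-cong : ∀ {f g : ℕ → ℕ} n → (∀ j → j < n → f j ≡ g j) →
                     sum (applyUpTo f n) ≡ sum (applyUpTo g n)
sum-applyUpTo-cong zero    f≗g = refl
sum-applyUpTo-cong (suc n) f≗g =
  cong₂ _+_ (f≗g 0 z<s) (sum-applyUpTo-cong n (λ j j<n → f≗g (suc j) (s≤s j<n)))

sum-applyUpTo-zero : ∀ {f : ℕ → ℕ} n → (∀ j → f j ≡ 0) → sum (applyUpTo f n) ≡ 0
sum-applyUpTo-zero zero    f≗0 = refl
sum-applyUpTo-zero (suc n) f≗0 = cong₂ _+_ (f≗0 0) (sum-applyUpTo-zero n (λ j → f≗0 (suc j)))

sum-applyUpTo-truncate : ∀ {f : ℕ → ℕ} {m n} → m ≤ n → (∀ j → m ≤ j → f j ≡ 0) →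
                         sum (applyUpTo f n) ≡ sum (applyUpTo f m)
sum-applyUpTo-truncate {n = n} z≤n f≗0 = sum-applyUpTo-zero n (λ j → f≗0 j z≤n)
sum-applyUpTo-truncate {f} (s≤s m≤n) f≗0 =
  cong (λ x → f 0 + x) (sum-applyUpTo-truncate m≤n (λ j m≤j → f≗0 (suc j) (s≤s m≤j)))

infixl 7 _⊛_

_⊛_ : (ℕ → ℕ) → (ℕ → ℕ) → ℕ → ℕ
(f ⊛ g) n = sum (applyUpTo (λ j → f j * g (n ∸ j)) (suc n))

-- The n-th coefficient of a product involves only coefficients up to n. Hence counts with bounded
-- parts can later replace `pod` and `p`.
⊛-cong : ∀ {f f′ g g′} n → (∀ m → m ≤ n → f m ≡ f′ m) → (∀ m → m ≤ n → g m ≡ g′ m) →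
         (f ⊛ g) n ≡ (f′ ⊛ g′) n
⊛-cong n f≗f′ g≗g′ =
  sum-applyUpTo-cong (suc n) (λ j j<1+n → cong₂ _*_ (f≗f′ j (s≤s⁻¹ j<1+n)) (g≗g′ (n ∸ j) (m∸n≤m n j)))

⊛-distribʳ-+ : ∀ f g h n → ((λ m → f m + g m) ⊛ h) n ≡ (f ⊛ h) n + (g ⊛ h) n
⊛-distribʳ-+ f g h zero = trans (cong (_+ 0) (*-distribʳ-+ (h 0) (f 0) (g 0)))
  (interchange (f 0 * h 0) (g 0 * h 0) 0 0)
-- Once the j = 0 summand is split off, the rest is by computation the n-th coefficient of a product
-- with the tail of the left factor, so the induction varies the left factors.
⊛-distribʳ-+ f g h (suc n) =
  trans (cong₂ _+_ (*-distribʳ-+ (h (suc n)) (f 0) (g 0)) (⊛-distribʳ-+ (f ∘ suc) (g ∘ suc) h n))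
        (interchange (f 0 * h (suc n)) _ _ _)

⊛-distribˡ-+ : ∀ f g h n → (f ⊛ (λ m → g m + h m)) n ≡ (f ⊛ g) n + (f ⊛ h) n
⊛-distribˡ-+ f g h zero = trans (cong (_+ 0) (*-distribˡ-+ (f 0) (g 0) (h 0)))
  (interchange (f 0 * g 0) (f 0 * h 0) 0 0)
⊛-distribˡ-+ f g h (suc n) =
  trans (cong₂ _+_ (*-distribˡ-+ (f 0) (g (suc n)) (h (suc n))) (⊛-distribˡ-+ (f ∘ suc) g h n))
        (interchange (f 0 * g (suc n)) _ _ _)

⊛-shiftˡ : ∀ d f g n → (shift d f ⊛ g) n ≡ shift d (f ⊛ g) n
⊛-shiftˡ zero    f g n       = refl
⊛-shiftˡ (suc d) f g zero    = refl
⊛-shiftˡ (suc d) f g (suc n) = ⊛-shiftˡ d f g n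

-- In a right factor the leading zero of the shift meets the last summand, so the summands before it
-- are passed by induction. In a left factor it meets the first, and `⊛-shiftˡ` holds by
-- computation.
⊛-shift-suc : ∀ d f g n → (f ⊛ shift (suc d) g) (suc n) ≡ (f ⊛ shift d g) n
⊛-shift-suc d f g zero    = cong (λ x → f 0 * shift d g 0 + x)
                                 (trans (+-identityʳ _) (*-zeroʳ (f 1)))
⊛-shift-suc d f g (suc n) = cong (λ x → f 0 * shift d g (suc n) + x) (⊛-shift-suc d (f ∘ suc) g n)

⊛-shiftʳ : ∀ d f g n → (f ⊛ shift d g) n ≡ shift d (f ⊛ g) n
⊛-shiftʳ zero    f g n       = refl
⊛-shiftʳ (suc d) f g zero    = trans (+-identityʳ _) (*-zeroʳ (f 0))
⊛-shiftʳ (suc d) f g (suc n) = trans (⊛-shift-suc d f g n) (⊛-shiftʳ d f g n)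

⊛-1+q^ˡ : ∀ d {f f′} g → (∀ n → f′ n ≡ f n + shift d f n) →
          ∀ n → (f′ ⊛ g) n ≡ (f ⊛ g) n + shift d (f ⊛ g) n
⊛-1+q^ˡ d {f} {f′} g f′≗ n = begin
  (f′ ⊛ g) n                              ≡⟨ ⊛-cong {g = g} n (λ m _ → f′≗ m) (λ _ _ → refl) ⟩
  ((λ m → f m + shift d f m) ⊛ g) n       ≡⟨ ⊛-distribʳ-+ f (shift d f) g n ⟩
  (f ⊛ g) n + (shift d f ⊛ g) n           ≡⟨ cong (λ x → (f ⊛ g) n + x) (⊛-shiftˡ d f g n) ⟩
  (f ⊛ g) n + shift d (f ⊛ g) n           ∎
  where open ≡-Reasoning

⊛-quotientˡ : ∀ d {f h} g → f ≈[1-q^ d ] h → (f ⊛ g) ≈[1-q^ d ] (h ⊛ g)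
⊛-quotientˡ d {f} {h} g fh n = begin
  (h ⊛ g) n                              ≡⟨ ⊛-cong {g = g} n (λ m _ → fh m) (λ _ _ → refl) ⟩
  ((λ m → f m + shift d h m) ⊛ g) n      ≡⟨ ⊛-distribʳ-+ f (shift d h) g n ⟩
  (f ⊛ g) n + (shift d h ⊛ g) n          ≡⟨ cong (λ x → (f ⊛ g) n + x) (⊛-shiftˡ d h g n) ⟩
  (f ⊛ g) n + shift d (h ⊛ g) n          ∎
  where open ≡-Reasoning

⊛-quotientʳ : ∀ d f {g h} → g ≈[1-q^ d ] h → (f ⊛ g) ≈[1-q^ d ] (f ⊛ h)
⊛-quotientʳ d f {g} {h} gh n = begin
  (f ⊛ h) n                              ≡⟨ ⊛-cong {f} n (λ _ _ → refl) (λ m _ → gh m) ⟩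
  (f ⊛ (λ m → g m + shift d h m)) n      ≡⟨ ⊛-distribˡ-+ f g (shift d h) n ⟩
  (f ⊛ g) n + (f ⊛ shift d h) n          ≡⟨ cong (λ x → (f ⊛ g) n + x) (⊛-shiftʳ d f h n) ⟩
  (f ⊛ g) n + shift d (f ⊛ h) n          ∎
  where open ≡-Reasoning

-- The substitution q ↦ q^d

dilate : ℕ → (ℕ → ℕ) → ℕ → ℕ
dilate d f n with d ∣? n
... | yes (divides m _) = f m
... | no _              = 0

dilate-* : ∀ d f m → dilate (suc d) f (m * suc d) ≡ f m
dilate-* d f m with suc d ∣? (m * suc d)
-- The quotient found by the decision procedure is not syntactically m; cancelling `suc d`
-- identifies the two.
... | yes (divides m′ eq) = cong f (sym (*-cancelʳ-≡ m m′ (suc d) eq))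
... | no ∤                = contradiction (n∣m*n m) ∤

dilate-∤ : ∀ {d} f {n} → ¬ d ∣ n → dilate d f n ≡ 0
dilate-∤ {d} f {n} ∤ with d ∣? n
... | yes d∣n = contradiction d∣n ∤
... | no _    = refl

dilate-cong : ∀ d {f g n} → (∀ m → m ≤ n → f m ≡ g m) → dilate (suc d) f n ≡ dilate (suc d) g n
dilate-cong d {n = n} f≗g with suc d ∣? n
... | yes (divides m refl) = f≗g m (m≤m*n m (suc d))
... | no _                 = refl

shift-dilate-* : ∀ d k f m → shift (k * suc d) (dilate (suc d) f) (m * suc d) ≡ shift k f m
shift-dilate-* d zero    f m       = dilate-* d f m
shift-dilate-* d (suc k) f zero    = refl
-- Shift and index both grow by `suc d`; one unit computes away and `shift-cancel` removes the other
-- d.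
shift-dilate-* d (suc k) f (suc m) = trans (shift-cancel d) (shift-dilate-* d k f m)
  where
  shift-cancel : ∀ e {a b h} → shift (e + a) h (e + b) ≡ shift a h b
  shift-cancel zero    = refl
  shift-cancel (suc e) = shift-cancel e

shift-dilate-∤ : ∀ d k f {n} → ¬ d ∣ n → shift (k * d) (dilate d f) n ≡ 0
shift-dilate-∤ d k f {n} d∤n with <-≤-connex n (k * d)
... | inj₁ n<kd = shift-< _ n<kd
... | inj₂ kd≤n = begin
  shift (k * d) (dilate d f) n                        ≡⟨ cong (shift (k * d) (dilate d f)) (m+[n∸m]≡n kd≤n) ⟨
  shift (k * d) (dilate d f) (k * d + (n ∸ k * d))    ≡⟨ shift-≤ (k * d) (dilate d f) (n ∸ k * d) ⟩
  dilate d f (n ∸ k * d)                              ≡⟨ dilate-∤ f (λ d∣ →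
    d∤n (subst (d ∣_) (m+[n∸m]≡n kd≤n) (∣m∣n⇒∣m+n (n∣m*n k) d∣))) ⟩
  0                                                   ∎
  where open ≡-Reasoning

-- Substituting q^{d+1} for q turns 1 - q^k into 1 - q^{k(d+1)}. At indices not divisible by d + 1
-- all three terms vanish.
dilate-quotient : ∀ d k {f h} → f ≈[1-q^ k ] h →
                  dilate (suc d) f ≈[1-q^ k * suc d ] dilate (suc d) h
dilate-quotient d k {f} {h} fh n = by-divisibility (suc d ∣? n)
  where
  by-divisibility : Dec (suc d ∣ n) →
    dilate (suc d) h n ≡ dilate (suc d) f n + shift (k * suc d) (dilate (suc d) h) n
  by-divisibility (yes (divides m refl)) =
    trans (dilate-* d h m)
      (trans (fh m) (sym (cong₂ _+_ (dilate-* d f m) (shift-dilate-* d k h m))))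
  by-divisibility (no ∤) =
    trans (dilate-∤ h ∤) (sym (cong₂ _+_ (dilate-∤ f ∤) (shift-dilate-∤ (suc d) k h ∤)))

-- Counting partitions with bounded parts

-- The series f / (1 - q^{d+1}), expanded as a geometric series. The range of m is the range of
-- multiplicities in `partitions≤`.
geometricSum : ℕ → (ℕ → ℕ) → ℕ → ℕ
geometricSum d f n = sum (applyUpTo (λ m → f (n ∸ m * suc d)) (suc (n ℕ./ suc d)))

geometricSum-< : ∀ d f {n} → n < suc d → geometricSum d f n ≡ f n
geometricSum-< d f {n} n<d rewrite ℕ.m<n⇒m/n≡0 n<d = +-identityʳ (f n)

/-suc : ∀ d n → (suc d + n) ℕ./ suc d ≡ suc (n ℕ./ suc d)
/-suc d n = trans (ℕ.m/n≡1+[m∸n]/n (m≤m+n (suc d) n)) (cong (λ x → suc (x ℕ./ suc d)) (m+n∸m≡n (suc d) n))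

-- The m = 0 term is f n. The later terms form the same sum at n - (d + 1), whose range is shorter
-- by one; for n < d + 1 there are none.
quotient-geometricSum : ∀ d f → f ≈[1-q^ suc d ] geometricSum d f
quotient-geometricSum d f n with <-≤-connex n (suc d)
... | inj₁ n<d = trans (geometricSum-< d f n<d)
      (sym (trans (cong (λ x → f n + x) (shift-< (geometricSum d f) n<d)) (+-identityʳ (f n))))
... | inj₂ d≤n = subst Goal (m+[n∸m]≡n d≤n) (step (n ∸ suc d))
  where
  Goal : ℕ → Set
  Goal n = geometricSum d f n ≡ f n + shift (suc d) (geometricSum d f) n
  step : ∀ m → Goal (suc d + m)
  step m rewrite /-suc d m = cong (λ x → f (suc d + m) + x) (trans
    (sum-applyUpTo-cong (suc (m ℕ./ suc d)) (λ j _ → cong f ([m+n]∸[m+o]≡n∸o (suc d) m (j * suc d))))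
    (sym (shift-≤ (suc d) (geometricSum d f) m)))

-- Stated for an arbitrary additive φ so as to serve both `length` and the count of lists with
-- distinct odd parts.
additive-concatMap-upTo : ∀ {A : Set} (φ : List A → ℕ) → φ [] ≡ 0 → (∀ xs ys → φ (xs ++ ys) ≡ φ xs + φ ys) →
  ∀ (F : ℕ → List A) n → φ (concatMap F (upTo n)) ≡ sum (applyUpTo (φ ∘ F) n)
additive-concatMap-upTo φ φ[] φ++ F n = trans (concatMap-sum (upTo n)) (cong sum (map-upTo (φ ∘ F) n))
  where
  concatMap-sum : ∀ ms → φ (concatMap F ms) ≡ sum (map (φ ∘ F) ms)
  concatMap-sum []       = φ[]
  concatMap-sum (m ∷ ms) = trans (φ++ (F m) _) (cong (λ x → φ (F m) + x) (concatMap-sum ms))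

count : {A : Set} {P : Pred A 0ℓ} → Decidable P → List A → ℕ
count P? xs = length (filter P? xs)

count-++ : ∀ {A : Set} {P : Pred A 0ℓ} (P? : Decidable P) xs ys →
           count P? (xs ++ ys) ≡ count P? xs + count P? ys
count-++ P? xs ys = trans (cong length (filter-++ P? xs ys)) (length-++ (filter P? xs))

-- The equivalence is asked only on the entries of the list, because prepending an odd part respects
-- distinctness only under a bound on the parts.
count-map : ∀ {A B : Set} {P : Pred A 0ℓ} {Q : Pred B 0ℓ} (P? : Decidable P) (Q? : Decidable Q)
            {f : A → B} {xs} → All (λ x → P x ⇔ Q (f x)) xs → count Q? (map f xs) ≡ count P? xs
count-map P? Q? [] = refl
count-map P? Q? {f} {x ∷ xs} (P⇔Q ∷ eqs) with P? x | Q? (f x)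
... | yes _  | yes _  = cong suc (count-map P? Q? eqs)
... | no _   | no _   = count-map P? Q? eqs
... | yes px | no ¬qx = contradiction (Equivalence.to P⇔Q px) ¬qx
... | no ¬px | yes qx = contradiction (Equivalence.from P⇔Q qx) ¬px

count-none : ∀ {A : Set} {P : Pred A 0ℓ} (P? : Decidable P) {xs} → All (λ x → ¬ P x) xs → count P? xs ≡ 0
count-none P? none = cong length (filter-none P? none)

p≤ : ℕ → ℕ → ℕ
p≤ k n = length (partitions≤ k n)

pod≤ : ℕ → ℕ → ℕ
pod≤ k n = count oddPartsDistinct? (partitions≤ k n)

withMultiplicity : (k n m : ℕ) → List (List ℕ)
withMultiplicity k n m = map (replicate m (suc k) ++_) (partitions≤ k (n ∸ m * suc k))

-- Ensures that a prepended part k + 1 differs from all parts already present.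
partitions≤-bounded : ∀ k n → All (All (_≤ k)) (partitions≤ k n)
partitions≤-bounded zero    zero    = [] ∷ []
partitions≤-bounded zero    (suc n) = []
partitions≤-bounded (suc k) n = All.concat⁺ (All.map⁺ (All.universal
  (λ m → All.map⁺ (All.map (λ ps≤k → All.++⁺ (All.replicate⁺ m ≤-refl) (All.map m≤n⇒m≤1+n ps≤k))
                           (partitions≤-bounded k (n ∸ m * suc k))))
  (upTo (suc (n ℕ./ suc k)))))

p≤-suc : ∀ k → p≤ (suc k) ≗ geometricSum k (p≤ k)
p≤-suc k n = trans
  (additive-concatMap-upTo length refl (λ xs ys → length-++ xs) (withMultiplicity k n) (suc (n ℕ./ suc k)))
  (sum-applyUpTo-cong (suc (n ℕ./ suc k)) (λ m _ →
    length-map (replicate m (suc k) ++_) (partitions≤ k (n ∸ m * suc k))))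

quotient-≗ : ∀ d {f h k} → h ≗ k → f ≈[1-q^ d ] k → f ≈[1-q^ d ] h
quotient-≗ d {f} h≗k fk n = trans (h≗k n)
  (trans (fk n) (cong (λ x → f n + x) (shift-cong d n (λ m _ → sym (h≗k m)))))

p≤-quotient : ∀ k → p≤ k ≈[1-q^ suc k ] p≤ (suc k)
p≤-quotient k = quotient-≗ (suc k) (p≤-suc k) (quotient-geometricSum k (p≤ k))

pod≤-suc : ∀ k n → pod≤ (suc k) n ≡
  sum (applyUpTo (count oddPartsDistinct? ∘ withMultiplicity k n) (suc (n ℕ./ suc k)))
pod≤-suc k n = additive-concatMap-upTo (count oddPartsDistinct?) refl (count-++ oddPartsDistinct?)
  (withMultiplicity k n) (suc (n ℕ./ suc k))

filter-odd-replicate-even : ∀ m {d} ps → 2 ∣ d → filter odd? (replicate m d ++ ps) ≡ filter odd? ps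
filter-odd-replicate-even m {d} ps 2∣d = trans (filter-++ odd? (replicate m d) ps)
  (cong (_++ filter odd? ps) (filter-none odd? (All.replicate⁺ m (λ d-odd → d-odd 2∣d))))

-- Copies of an even part leave the list of odd parts unchanged, so every multiplicity is allowed
-- and the new factor is a full geometric series.
pod≤-quotient-even : ∀ k → 2 ∣ suc k → pod≤ k ≈[1-q^ suc k ] pod≤ (suc k)
pod≤-quotient-even k even = quotient-≗ (suc k)
  (λ n → trans (pod≤-suc k n)
    (sum-applyUpTo-cong (suc (n ℕ./ suc k)) (λ m _ → count-map oddPartsDistinct? oddPartsDistinct? {replicate m (suc k) ++_}
      (All.universal (prepend m) (partitions≤ k (n ∸ m * suc k))))))
  (quotient-geometricSum k (pod≤ k))
  where
  prepend : ∀ m ps → OddPartsDistinct ps ⇔ OddPartsDistinct (replicate m (suc k) ++ ps)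
  prepend m ps rewrite filter-odd-replicate-even m ps even = mk⇔ (λ u → u) (λ u → u)

prepend-odd : ∀ {k ps} → Odd (suc k) → All (_≤ k) ps → OddPartsDistinct ps ⇔ OddPartsDistinct (suc k ∷ ps)
prepend-odd {k} {ps} odd ps≤k rewrite filter-accept odd? {xs = ps} odd = mk⇔
  (All.map (λ x≤k 1+k≡x → 1+n≰n (subst (_≤ k) (sym 1+k≡x) x≤k)) (All.filter⁺ odd? ps≤k) ∷_)
  (λ where (_ ∷ u) → u)

repeat-odd : ∀ {k ps} → Odd k → ¬ OddPartsDistinct (k ∷ k ∷ ps)
repeat-odd {k} {ps} odd u rewrite filter-accept odd? {xs = k ∷ ps} odd | filter-accept odd? {xs = ps} odd
  with (k≢k ∷ _) ∷ _ ← u = k≢k refl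

-- Of the multiplicities of an odd part only 0 and 1 survive, which gives the factor 1 + q^{k+1}.
pod≤-odd : ∀ k → Odd (suc k) → ∀ n → pod≤ (suc k) n ≡ pod≤ k n + shift (suc k) (pod≤ k) n
pod≤-odd k odd n = trans (pod≤-suc k n)
  -- Multiplicity 0 leaves a `map` along the identity, which does not compute away on its own.
  (cong₂ _+_ (count-map oddPartsDistinct? oddPartsDistinct? {λ ps → ps}
               (All.universal (λ _ → mk⇔ (λ u → u) (λ u → u)) (partitions≤ k n)))
             (rest n))
  where
  term : ℕ → ℕ → ℕ
  term n m = count oddPartsDistinct? (withMultiplicity k n m)
  term-once : ∀ n → term (suc k + n) 1 ≡ pod≤ k n
  term-once n = trans
    (count-map oddPartsDistinct? oddPartsDistinct? {suc k ∷_}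
      (All.map (prepend-odd odd) (partitions≤-bounded k (suc k + n ∸ 1 * suc k))))
    (cong (pod≤ k) (trans (cong (suc k + n ∸_) (*-identityˡ (suc k))) (m+n∸m≡n (suc k) n)))
  term-repeated : ∀ n m → term n (suc (suc m)) ≡ 0
  term-repeated n m = count-none oddPartsDistinct? (All.map⁺
    (All.universal (λ ps → repeat-odd {ps = replicate m (suc k) ++ ps} odd)
                   (partitions≤ k (n ∸ suc (suc m) * suc k))))
  rest-+ : ∀ n → sum (applyUpTo (term (suc k + n) ∘ suc) ((suc k + n) ℕ./ suc k)) ≡ pod≤ k n
  rest-+ n rewrite /-suc k n = trans
    (cong₂ _+_ (term-once n) (sum-applyUpTo-zero (n ℕ./ suc k) (term-repeated (suc k + n))))
    (+-identityʳ _)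
  rest : ∀ n → sum (applyUpTo (term n ∘ suc) (n ℕ./ suc k)) ≡ shift (suc k) (pod≤ k) n
  rest n with <-≤-connex n (suc k)
  -- No copy of k + 1 fits into n, so the range of positive multiplicities is empty.
  ... | inj₁ n<k rewrite ℕ.m<n⇒m/n≡0 n<k = sym (shift-< (pod≤ k) n<k)
  ... | inj₂ k≤n = subst
    (λ n → sum (applyUpTo (term n ∘ suc) (n ℕ./ suc k)) ≡ shift (suc k) (pod≤ k) n)
    (m+[n∸m]≡n k≤n) (trans (rest-+ (n ∸ suc k)) (sym (shift-≤ (suc k) (pod≤ k) (n ∸ suc k))))

-- A part larger than n cannot occur in a partition of n, so raising the bound beyond n changes
-- nothing. The hypothesis expresses this for one step.
stable : ∀ (c : ℕ → ℕ → ℕ) → (∀ k n → n < suc k → c (suc k) n ≡ c k n) →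
         ∀ {k n} → n ≤ k → c k n ≡ c n n
stable c step n≤k = go (≤⇒≤′ n≤k)
  where
  go : ∀ {k n} → n ≤′ k → c k n ≡ c n n
  go ≤′-refl                 = refl
  go {suc k} (≤′-step n≤′k) = trans (step k _ (s≤s (≤′⇒≤ n≤′k))) (go n≤′k)

p≤-stable : ∀ {k n} → n ≤ k → p≤ k n ≡ p n
p≤-stable = stable p≤ (λ k n n<1+k → trans (p≤-suc k n) (geometricSum-< k (p≤ k) n<1+k))

pod≤-stable : ∀ {k n} → n ≤ k → pod≤ k n ≡ pod n
pod≤-stable = stable pod≤ step
  where
  step : ∀ k n → n < suc k → pod≤ (suc k) n ≡ pod≤ k n
  step k n n<1+k with 2 ∣? suc k
  ... | yes even = trans (pod≤-quotient-even k even n)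
                     (trans (cong (λ x → pod≤ k n + x) (shift-< (pod≤ (suc k)) n<1+k)) (+-identityʳ _))
  ... | no odd   = trans (pod≤-odd k odd n)
                     (trans (cong (λ x → pod≤ k n + x) (shift-< (pod≤ k) n<1+k)) (+-identityʳ _))

-- The identity for finite products and its limit

odd-1+2m : ∀ m → Odd (suc (m * 2))
odd-1+2m m 2∣ with () ← ∣1⇒≡1 (∣m+n∣m⇒∣n (subst (2 ∣_) (+-comm 1 (m * 2)) 2∣) (n∣m*n m))

-- `p≤ 0` is the constant series 1, which every such substitution fixes.
dilate-p≤0 : ∀ d → dilate (suc d) (p≤ 0) ≗ p≤ 0
dilate-p≤0 d zero    = refl
dilate-p≤0 d (suc n) with suc d ∣? suc n
... | yes (divides (suc _) _) = refl
... | no _                    = refl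

product-identity : ∀ m → pod≤ (m * 2) ⊛ dilate 2 (p≤ (m * 2)) ≗ p≤ (m * 2) ⊛ dilate 4 (p≤ m)
product-identity zero n =
  ⊛-cong n (λ j _ → pod≤0≗p≤0 j) (λ j _ → trans (dilate-p≤0 1 j) (sym (dilate-p≤0 3 j)))
  where
  pod≤0≗p≤0 : pod≤ 0 ≗ p≤ 0
  pod≤0≗p≤0 zero    = refl
  pod≤0≗p≤0 (suc n) = refl
product-identity (suc m) =
  -- The outer application accounts for the common factor 1/(1 - q^{2m+2}), the inner one for 1/(1 -
  -- q^{4m+4}); what remains is the passage through the odd part 2m + 1.
  quotient-unique (suc k)
    (⊛-quotientˡ (suc (suc k)) B₂ (pod≤-quotient-even (suc k) (n∣m*n (suc m))))
    (⊛-quotientˡ (suc (suc k)) D₁ (p≤-quotient (suc k)))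
    (quotient-unique (suc (suc k * 2))
      (⊛-quotientʳ (suc (suc k) * 2) (pod≤ (suc k)) (dilate-quotient 1 (suc (suc k)) (p≤-quotient (suc k))))
      -- The part 2m + 2 under q ↦ q² and the part m + 1 under q ↦ q⁴ give the same exponent 4m + 4,
      -- written as two different products.
      (subst (λ d → (p≤ (suc k) ⊛ D₀) ≈[1-q^ d ] (p≤ (suc k) ⊛ D₁)) (sym (*-assoc (suc m) 2 2))
        (⊛-quotientʳ (suc m * 4) (p≤ (suc k)) (dilate-quotient 3 (suc m) (p≤-quotient m))))
      odd-step)
  where
  k = m * 2
  B₀ = dilate 2 (p≤ k)
  B₁ = dilate 2 (p≤ (suc k))
  B₂ = dilate 2 (p≤ (suc (suc k)))
  D₀ = dilate 4 (p≤ m)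
  D₁ = dilate 4 (p≤ (suc m))
  -- On the right the fourth-power factor stays at `D₀`, since its bound m grows only together with
  -- the even part.
  odd-step : pod≤ (suc k) ⊛ B₁ ≗ p≤ (suc k) ⊛ D₀
  odd-step = quotient-unique k
    (quotient-double k (⊛-1+q^ˡ (suc k) B₀ (pod≤-odd k (odd-1+2m m)))
      (subst (λ d → (pod≤ (suc k) ⊛ B₀) ≈[1-q^ d ] (pod≤ (suc k) ⊛ B₁))
        (trans (*-comm (suc k) 2) (cong (λ x → suc k + x) (+-identityʳ (suc k))))
        (⊛-quotientʳ (suc k * 2) (pod≤ (suc k)) (dilate-quotient 1 (suc k) (p≤-quotient k)))))
    (⊛-quotientˡ (suc k) D₀ (p≤-quotient k))
    (product-identity m)

pod⊛p : pod ⊛ dilate 2 p ≗ p ⊛ dilate 4 p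
pod⊛p n = begin
  (pod ⊛ dilate 2 p) n
    ≡⟨ ⊛-cong n (λ j j≤n → pod≤-stable (≤-trans j≤n n≤2n))
                (λ j j≤n → dilate-cong 1 (λ m m≤j → p≤-stable (≤-trans m≤j (≤-trans j≤n n≤2n)))) ⟨
  (pod≤ (n * 2) ⊛ dilate 2 (p≤ (n * 2))) n
    -- The finite identity is taken at M = n: both bounds 2n and n are then large enough for the
    -- coefficients up to n.
    ≡⟨ product-identity n n ⟩
  (p≤ (n * 2) ⊛ dilate 4 (p≤ n)) n
    ≡⟨ ⊛-cong n (λ j j≤n → p≤-stable (≤-trans j≤n n≤2n))
                (λ j j≤n → dilate-cong 3 (λ m m≤j → p≤-stable (≤-trans m≤j j≤n))) ⟩
  (p ⊛ dilate 4 p) n ∎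
  where
  open ≡-Reasoning
  n≤2n : n ≤ n * 2
  n≤2n = m≤m*n n 2

-- Evaluation of pℚ

toℚᵘ-difference : ∀ d n j → toℚᵘ ((+ n / suc d) - (+ j / suc d)) ≃ᵘ mkℚᵘ (+ n) d ℚᵘ.- mkℚᵘ (+ j) d
toℚᵘ-difference d n j = ℚᵘ.≃-trans (toℚᵘ-homo-+ x (ℚ.- y))
  (ℚᵘ.+-cong (toℚᵘ-fromℚᵘ (mkℚᵘ (+ n) d))
             (ℚᵘ.≃-trans (toℚᵘ-homo‿- y) (ℚᵘ.-‿cong (toℚᵘ-fromℚᵘ (mkℚᵘ (+ j) d)))))
  where
  x = + n / suc d
  y = + j / suc d

-- Equality of unnormalised rationals is cross-multiplication, here (nD - jD) · 1 = m · D² with D =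
-- d + 1; cancelling one D leaves n - j = mD.
difference-integer : ∀ d n j m → mkℚᵘ (+ n) d ℚᵘ.- mkℚᵘ (+ j) d ≃ᵘ mkℚᵘ (+ m) 0 ⇔ n ≡ j + m * suc d
difference-integer d n j m = mk⇔ to from
  where
  D = + suc d
  pos : + (j + m * suc d) ≡ + j ℤ.+ + m ℤ.* D
  pos = trans (ℤ.pos-+ j (m * suc d)) (cong (λ x → + j ℤ.+ x) (ℤ.pos-* m (suc d)))
  cross : ∀ a b c e → (a ℤ.* e ℤ.+ ℤ.- b ℤ.* e) ℤ.* ℤ.1ℤ ≡ c ℤ.* (e ℤ.* e) →
          a ℤ.* e ≡ (b ℤ.+ c ℤ.* e) ℤ.* e
  cross a b c e eq = begin
    a ℤ.* e                                                    ≡⟨ restore a b e ⟩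
    (a ℤ.* e ℤ.+ ℤ.- b ℤ.* e) ℤ.* ℤ.1ℤ ℤ.+ b ℤ.* e             ≡⟨ cong (ℤ._+ b ℤ.* e) eq ⟩
    c ℤ.* (e ℤ.* e) ℤ.+ b ℤ.* e                                ≡⟨ collect b c e ⟩
    (b ℤ.+ c ℤ.* e) ℤ.* e                                      ∎
    where
    open ≡-Reasoning
    restore : ∀ a b e → a ℤ.* e ≡ (a ℤ.* e ℤ.+ ℤ.- b ℤ.* e) ℤ.* ℤ.1ℤ ℤ.+ b ℤ.* e
    restore = solve-∀
    collect : ∀ b c e → c ℤ.* (e ℤ.* e) ℤ.+ b ℤ.* e ≡ (b ℤ.+ c ℤ.* e) ℤ.* e
    collect = solve-∀
  expand : ∀ b c e → ((b ℤ.+ c ℤ.* e) ℤ.* e ℤ.+ ℤ.- b ℤ.* e) ℤ.* ℤ.1ℤ ≡ c ℤ.* (e ℤ.* e)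
  expand = solve-∀
  to : mkℚᵘ (+ n) d ℚᵘ.- mkℚᵘ (+ j) d ≃ᵘ mkℚᵘ (+ m) 0 → n ≡ j + m * suc d
  to (*≡* eq) = ℤ.+-injective (trans
    (ℤ.*-cancelʳ-≡ (+ n) (+ j ℤ.+ + m ℤ.* D) D (cross (+ n) (+ j) (+ m) D eq)) (sym pos))
  from : n ≡ j + m * suc d → mkℚᵘ (+ n) d ℚᵘ.- mkℚᵘ (+ j) d ≃ᵘ mkℚᵘ (+ m) 0
  from refl = *≡* (trans
    (cong (λ x → (x ℤ.* D ℤ.+ ℤ.- (+ j) ℤ.* D) ℤ.* ℤ.1ℤ) pos) (expand (+ j) (+ m) D))

-- `pℚ` inspects the reduced form, so q is first identified with m over 1; then it computes.
pℚ-integer : ∀ q m → toℚᵘ q ≃ᵘ mkℚᵘ (+ m) 0 → pℚ q ≡ p m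
pℚ-integer q m q≃m = cong pℚ (toℚᵘ-injective {q} {mkℚ (+ m) 0 (coprime-sym (1-coprimeTo m))} q≃m)

pℚ-non-integer : ∀ q → (∀ m → ¬ toℚᵘ q ≃ᵘ mkℚᵘ (+ m) 0) → pℚ q ≡ 0
-- The only form on which `pℚ` evaluates p is excluded by taking m = n.
pℚ-non-integer (mkℚ (+ n)       zero    _) q≄ = contradiction ℚᵘ.≃-refl (q≄ n)
pℚ-non-integer (mkℚ (+ n)       (suc _) _) _  = refl
pℚ-non-integer (mkℚ ℤ.-[1+ _ ]  _       _) _  = refl

pℚ-difference : ∀ d n j m → n ≡ j + m * suc d → pℚ ((+ n / suc d) - (+ j / suc d)) ≡ p m
pℚ-difference d n j m n≡ = pℚ-integer ((+ n / suc d) - (+ j / suc d)) m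
  (ℚᵘ.≃-trans (toℚᵘ-difference d n j) (Equivalence.from (difference-integer d n j m) n≡))

pℚ-difference-0 : ∀ d n j → (∀ m → n ≢ j + m * suc d) → pℚ ((+ n / suc d) - (+ j / suc d)) ≡ 0
pℚ-difference-0 d n j n≢ = pℚ-non-integer ((+ n / suc d) - (+ j / suc d))
  (λ m q≃m → n≢ m (Equivalence.to (difference-integer d n j m)
                    (ℚᵘ.≃-trans (ℚᵘ.≃-sym (toℚᵘ-difference d n j)) q≃m)))

-- The bound j ≤ n matters: for j > n the left side is 0, whereas the truncated difference is 0 and
-- the right side would be p 0 = 1.
pℚ-difference-dilate : ∀ d n j → j ≤ n → pℚ ((+ n / suc d) - (+ j / suc d)) ≡ dilate (suc d) p (n ∸ j)
pℚ-difference-dilate d n j j≤n with suc d ∣? (n ∸ j)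
... | yes (divides m eq) = pℚ-difference d n j m (trans (sym (m+[n∸m]≡n j≤n)) (cong (λ x → j + x) eq))
... | no ∤ = pℚ-difference-0 d n j λ m n≡ → ∤ (divides m (trans (cong (_∸ j) n≡) (m+n∸m≡n j (m * suc d))))

-- For j > n the argument of `pℚ` is negative and the term vanishes, so the partial sums are
-- constant from n + 1 terms on and equal a Cauchy product coefficient.
hasSum-⊛ : ∀ (f : ℕ → ℕ) d n →
           HasSum (λ j → f j * pℚ ((+ n / suc d) - (+ j / suc d))) ((f ⊛ dilate (suc d) p) n)
hasSum-⊛ f d n = suc n , λ M n<M → trans
  (sum-applyUpTo-truncate n<M (λ j n<j → trans
    (cong (f j *_) (pℚ-difference-0 d n j (λ m n≡ → m+n≮m j (m * suc d) (subst (_< j) n≡ n<j))))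
    (*-zeroʳ (f j))))
  (sum-applyUpTo-cong (suc n) (λ j j<1+n → cong (f j *_) (pℚ-difference-dilate d n j (s≤s⁻¹ j<1+n))))

theorem4p12 : (n : ℕ) →
    ∃[ s ] (HasSum (λ j → pod j * pℚ ((+ n / 2) - (+ j / 2))) s
    × HasSum (λ j → p j * pℚ ((+ n / 4) - (+ j / 4))) s)
theorem4p12 n = (p ⊛ dilate 4 p) n , subst (HasSum _) (pod⊛p n) (hasSum-⊛ pod 1 n) , hasSum-⊛ p 3 n
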